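{- Let $n\ge 1$, let $C\subseteq\mathbb{Z}_4^n$ be a linear code over $\mathbb{Z}_4$, and let $C'\subseteq\mathbb{Z}_2^{2n}$ be its Gray map image. If $\mathrm{Str}(C)=t$, then $t\le \mathrm{Str}(C')\le 2t+1$.
   Context: $\mathbb{Z}_m$ denotes the ring of integers modulo $m$. A linear code $C$ of length $n$ over $\mathbb{Z}_4$ is a $\mathbb{Z}_4$-submodule of $\mathbb{Z}_4^n$. The Gray map takes $\mathbb{Z}_4$ to $\mathbb{Z}_2^2$ by $0\mapsto 00$, $1\mapsto 01$, $2\mapsto 11$, $3\mapsto 10$, and is extended coordinatewise to a map $\mathbb{Z}_4^n\to\mathbb{Z}_2^{2n}$. The Gray map image $C'$ of $C$ is the set of images of the codewords of $C$ under this map; it is in general a non-linear binary code. An $N\times k$ array with entries from a finite alphabet $F$ is an orthogonal array of strength $t$ and index $\lambda$ (where $0\le t\le k$) if every $N\times t$ subarray (obtained by choosing $t$ distinct columns) contains each $t$-tuple over $F$ exactly $\lambda$ times as a row. A code $D\subseteq F^k$ (linear or not) is an orthogonal array of strength $t$ if the array whose rows are the codewords of $D$, each listed once, is an orthogonal array of strength $t$ for some index $\lambda$. $\mathrm{Str}(D)$ denotes the strength of $D$, i.e. the largest $t$ with $0\le t\le k$ such that $D$ is an orthogonal array of strength $t$. For $C$ the alphabet is $F=\mathbb{Z}_4$ and $k=n$; for $C'$ the alphabet is $F=\mathbb{Z}_2$ and $k=2n$. -}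

module Defs where

open import Data.Fin using (Fin; toℕ; _≟_)
open import Data.Fin.Patterns using (0F; 1F; 2F; 3F)
open import Data.Nat using (ℕ; NonZero; _+_; _*_; _≤_)
open import Data.Nat.DivMod using (_mod_)
open import Data.Product using (∃-syntax; _×_)
open import Data.Vec using (Vec; []; _∷_; lookup; map; zipWith; replicate; concat; count)
open import Data.Vec.Membership.Propositional using () renaming (_∈_ to _∈ᵛ_)
open import Data.Vec.Properties using (≡-dec)
open import Data.Vec.Relation.Unary.Unique.Propositional using (Unique)
open import Function.Bundles using (_⇔_)
open import Level using (Level; suc)
open import Relation.Binary.PropositionalEquality using (_≡_)
open import Relation.Unary using (Pred; _∈_)

private
  variable
    ℓ : Level
    m q k n N t : ℕ

-- The integers modulo m, represented by their residues 0, …, m - 1.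
ℤ/ : ℕ → Set
ℤ/ m = Fin m

infixl 6 _+ₘ_
infixl 7 _*ₘ_

_+ₘ_ _*ₘ_ : .{{NonZero m}} → ℤ/ m → ℤ/ m → ℤ/ m
_+ₘ_ {m} a b = (toℕ a + toℕ b) mod m
_*ₘ_ {m} a b = (toℕ a * toℕ b) mod m

Code : (ℓ : Level) → Set → ℕ → Set (suc ℓ)
Code ℓ F k = Pred (Vec F k) ℓ

record IsLinear {n} (C : Code ℓ (ℤ/ 4) n) : Set ℓ where
  field
    0∈ : replicate n 0F ∈ C
    +∈ : ∀ {x y} → x ∈ C → y ∈ C → zipWith _+ₘ_ x y ∈ C
    *∈ : ∀ a {x} → x ∈ C → map (a *ₘ_) x ∈ C

gray₁ : ℤ/ 4 → Vec (ℤ/ 2) 2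
gray₁ 0F = 0F ∷ 0F ∷ []
gray₁ 1F = 0F ∷ 1F ∷ []
gray₁ 2F = 1F ∷ 1F ∷ []
gray₁ 3F = 1F ∷ 0F ∷ []

gray : Vec (ℤ/ 4) n → Vec (ℤ/ 2) (n * 2)
gray v = concat (map gray₁ v)

GrayImage : Code ℓ (ℤ/ 4) n → Code ℓ (ℤ/ 2) (n * 2)
GrayImage C w = ∃[ v ] v ∈ C × gray v ≡ w

-- An N × k array over an alphabet of size q, as the vector of its rows.
Array : (q N k : ℕ) → Set
Array q N k = Vec (Vec (Fin q) k) N

subarray : Vec (Fin k) t → Array q N k → Array q N t
subarray cols = map (λ row → map (lookup row) cols)

occurrences : Vec (Fin q) k → Array q N k → ℕ
occurrences u = count (≡-dec _≟_ u)

record IsOrthogonalArray {q N k} (A : Array q N k) (t index : ℕ) : Set where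
  field
    t≤k     : t ≤ k
    balance : (cols : Vec (Fin k) t) → Unique cols →
              (u : Vec (Fin q) t) → occurrences u (subarray cols A) ≡ index

-- The rows of A are the words of D, each occurring once.  The order of the
-- rows is immaterial to IsOrthogonalArray.
record Lists {q N k} (A : Array q N k) (D : Code ℓ (Fin q) k) : Set ℓ where
  field
    distinct : Unique A
    rows     : ∀ w → w ∈ᵛ A ⇔ w ∈ D

OAOfStrength : ∀ {q k} → Code ℓ (Fin q) k → ℕ → Set ℓ
OAOfStrength D t =
  ∃[ N ] ∃[ A ] Lists {N = N} A D × ∃[ index ] IsOrthogonalArray A t index

-- HasStr D t states that Str(D) is t: t is the largest strength of D.
record HasStr {q k} (D : Code ℓ (Fin q) k) (t : ℕ) : Set ℓ where
  field
    attained : OAOfStrength D t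
    largest  : ∀ s → OAOfStrength D s → s ≤ t

{-# OPTIONS --safe #-}
module Submission where

-- Call a pattern p, i.e. a partial word over an alphabet of size q, balanced
-- if exactly N / q^|p| of the N codewords extend it.  Strength t means that
-- all patterns of size at most t are balanced.  A pattern on C corresponds to
-- a pattern on C′ of twice the size whose blocks (pairs of columns that come
-- from one coordinate) are empty or full, and one is balanced iff the other
-- is.  Hence strength 2r of C′ gives strength r of C.  Conversely, p is
-- balanced as soon as all its extensions by one given column are, so the half
-- filled blocks of a pattern on C′ can be completed; a pattern of size at most
-- t meets at most t blocks.  Strength is decidable for a listed code, so the
-- largest strength of C′ is found by search.

open import Defs
open import Data.Bool using (true; false; if_then_else_)
open import Data.Fin using (Fin; zero; suc; _≟_)
open import Data.Fin.Patterns using (0F; 1F; 2F; 3F)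
open import Data.Fin.Properties using (all?; suc-injective)
open import Data.List as List using (List; length)
open import Data.List.Properties as List using ()
open import Data.List.Membership.Propositional.Properties.WithK using (unique∧set⇒bag)
open import Data.List.Relation.Binary.BagAndSetEquality using (∼bag⇒↭)
open import Data.List.Relation.Binary.Permutation.Propositional using (_↭_)
open import Data.List.Relation.Binary.Permutation.Propositional.Properties
  using (↭-length) renaming (map⁺ to ↭-map⁺)
open import Data.List.Relation.Unary.Unique.Propositional using ([]; _∷_) renaming (Unique to Uniqueₗ)
open import Data.Maybe using (Maybe; just; nothing)
import Data.Maybe.Relation.Unary.All as Maybe
open import Data.Nat using (ℕ; zero; suc; _+_; _*_; _^_; _∸_; _≤_; _<_; z≤n; s≤s; _≤?_)
open import Data.Nat.DivMod using (_/_; m*n/n≡m; /-congˡ)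
open import Data.Nat.ListAction using (sum)
open import Data.Nat.ListAction.Properties using (sum-↭)
open import Data.Nat.Properties as ℕ hiding (_≟_; suc-injective)
open import Data.Product using (∃-syntax; _×_; _,_; proj₁; proj₂; map₁; map₂)
open import Data.Vec using
  (Vec; []; _∷_; _++_; _[_]=_; _[_]≔_; here; there; lookup; map; replicate; concat; count; toList)
open import Data.Vec.Membership.Propositional using () renaming (_∈_ to _∈ᵛ_)
open import Data.Vec.Membership.Propositional.Properties using (∈-map⁺; ∈-toList⁺; ∈-toList⁻)
open import Data.Vec.Properties using
  (∷-injective; ++-injective; map-∘; ≡-dec; length-toList; toList-map;
   lookup-replicate; lookup⇒[]=; []≔-minimal)
open import Data.Vec.Relation.Binary.Pointwise.Inductive as Pointwise using (Pointwise; []; _∷_)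
open import Data.Vec.Relation.Unary.All as All using (All; []; _∷_)
import Data.Vec.Relation.Unary.All.Properties as All
open import Data.Vec.Relation.Unary.Any using (here; there)
open import Data.Vec.Relation.Unary.Unique.Propositional using (Unique; []; _∷_)
import Data.Vec.Relation.Unary.Unique.Propositional.Properties as Unique
open import Function using (_∘_; id; _⇔_; mk⇔; Equivalence)
import Function.Properties.Equivalence as ⇔
open import Level using (Level)
open import Relation.Binary.PropositionalEquality
open import Relation.Nullary using (Dec; yes; no; does; contradiction; _×-dec_; _→-dec_)
open import Relation.Nullary.Decidable using (map′)
open import Relation.Unary using (Pred; Decidable)
import Algebra.Properties.CommutativeMonoid.Sum +-0-commutativeMonoid as ∑

open Equivalence

private
  variable
    a ℓ : Level
    A B : Set a
    P Q : Set ℓ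
    q k n m t N : ℕ

-- Indicators, finite sums and bounded search.

𝟙 : Dec P → ℕ
𝟙 P? = if does P? then 1 else 0

𝟙-cong : (P? : Dec P) (Q? : Dec Q) → P ⇔ Q → 𝟙 P? ≡ 𝟙 Q?
𝟙-cong (yes _) (yes _) _   = refl
𝟙-cong (yes p) (no ¬q) p⇔q = contradiction (to p⇔q p) ¬q
𝟙-cong (no ¬p) (yes q) p⇔q = contradiction (from p⇔q q) ¬p
𝟙-cong (no _)  (no _)  _   = refl

𝟙-× : (P? : Dec P) (Q? : Dec Q) → 𝟙 (P? ×-dec Q?) ≡ 𝟙 P? * 𝟙 Q?
𝟙-× (yes _) (yes _) = refl
𝟙-× (yes _) (no _)  = refl
𝟙-× (no _)  _       = refl

∑-const : ∀ q c → ∑.sum {q} (λ _ → c) ≡ q * c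
∑-const zero    c = refl
∑-const (suc q) c = cong (c +_) (∑-const q c)

-- Summation against a Kronecker delta; it later splits the rows according to their letter in one
-- column.
∑-𝟙-≟ : ∀ (x : Fin q) c → ∑.sum (λ y → 𝟙 (x ≟ y) * c) ≡ c
∑-𝟙-≟ {suc q} zero c = begin
  c + 0 + ∑.sum {q} (λ _ → 0)  ≡⟨ cong₂ _+_ (+-identityʳ c) (∑.sum-replicate-zero q) ⟩
  c + 0                        ≡⟨ +-identityʳ c ⟩
  c                            ∎
  where open ≡-Reasoning
∑-𝟙-≟ {suc q} (suc x) c = ∑-𝟙-≟ x c

count≡sum : ∀ {P : Pred A ℓ} (P? : Decidable P) (xs : Vec A n) →
            count P? xs ≡ sum (List.map (𝟙 ∘ P?) (toList xs))
count≡sum P? []       = refl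
count≡sum P? (x ∷ xs) with does (P? x)
... | true  = cong suc (count≡sum P? xs)
... | false = count≡sum P? xs

-- The candidates are tried downwards from `m`. When `suc m` fails, `¬pm` excludes `r = suc m`, so
-- the maximum found below remains the maximum; `p0` guarantees that the search ends with a witness.
greatest : ∀ {P : Pred ℕ ℓ} → Decidable P → P 0 → ∀ m →
           ∃[ s ] P s × (∀ r → r ≤ m → P r → r ≤ s)
greatest P? p0 zero = 0 , p0 , λ r r≤0 _ → r≤0
greatest P? p0 (suc m) with P? (suc m) | greatest P? p0 m
... | yes pm | _ = suc m , pm , λ r r≤m _ → r≤m
... | no ¬pm | s , ps , s-max = s , ps , λ r r≤1+m pr →
  s-max r (≤-pred (≤∧≢⇒< r≤1+m λ { refl → ¬pm pr })) pr

-- Patterns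

Pattern : ℕ → ℕ → Set
Pattern q k = Vec (Maybe (Fin q)) k

size : Vec (Maybe A) k → ℕ
size []            = 0
size (nothing ∷ p) = size p
size (just _ ∷ p)  = suc (size p)

infix 4 _≼_ _≼?_

-- `Maybe.All` holds vacuously at `nothing`, which thus acts as a wildcard.
_≼_ : Pattern q k → Vec (Fin q) k → Set
_≼_ = Pointwise (λ m x → Maybe.All (x ≡_) m)

_≼?_ : (p : Pattern q k) (r : Vec (Fin q) k) → Dec (p ≼ r)
_≼?_ = Pointwise.decidable (λ m x → Maybe.dec (x ≟_) m)

free : (p : Vec (Maybe A) k) → size p < k → ∃[ i ] p [ i ]= nothing
free (nothing ∷ p) _         = zero , here
free (just _ ∷ p)  (s≤s p<k) = let i , p[i] = free p p<k in suc i , there p[i]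

size-≔ : ∀ {p : Vec (Maybe A) k} {i} x → p [ i ]= nothing → size (p [ i ]≔ just x) ≡ suc (size p)
size-≔                     x here         = refl
size-≔ {p = nothing ∷ _} x (there p[i]) = size-≔ x p[i]
size-≔ {p = just _ ∷ _}  x (there p[i]) = cong suc (size-≔ x p[i])

size-free : ∀ k → size (replicate k (nothing {A = A})) ≡ 0
size-free zero    = refl
size-free (suc k) = size-free k

free-≼ : (r : Vec (Fin q) k) → replicate k nothing ≼ r
free-≼ []      = []
free-≼ (x ∷ r) = Maybe.nothing ∷ free-≼ r

-- Position `i` must be free: overwriting a letter would lose the constraint that it imposes.
≔-≼ : ∀ {p : Pattern q k} {i} x {r} → p [ i ]= nothing →
      (p [ i ]≔ just x) ≼ r ⇔ (lookup r i ≡ x × p ≼ r)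
≔-≼ x {_ ∷ _} here = mk⇔
  (λ { (Maybe.just eq ∷ p≼r) → eq , Maybe.nothing ∷ p≼r })
  (λ { (eq , _ ∷ p≼r) → Maybe.just eq ∷ p≼r })
≔-≼ x {_ ∷ _} (there p[i]) = mk⇔
  (λ { (m ∷ p≼r) → map₂ (m ∷_) (to (≔-≼ x p[i]) p≼r) })
  (λ { (eq , m ∷ p≼r) → m ∷ from (≔-≼ x p[i]) (eq , p≼r) })

-- Exhaustive search, branching on whether the first entry is free or one of the finitely many
-- letters. It is what makes strength decidable.
allPatterns? : ∀ {P : Pred (Pattern q k) ℓ} → Decidable P → Dec (∀ p → P p)
allPatterns? {k = zero}  P? = map′ (λ { h [] → h }) (λ h → h []) (P? [])
allPatterns? {k = suc k} P? = map′
  (λ { (h , _) (nothing ∷ p) → h p ; (_ , h) (just x ∷ p) → h x p })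
  (λ h → (λ p → h (nothing ∷ p)) , (λ x p → h (just x ∷ p)))
  (allPatterns? (P? ∘ (nothing ∷_)) ×-dec all? (λ x → allPatterns? (P? ∘ (just x ∷_))))

-- Patterns as choices of distinct columns with prescribed values.

columns : (p : Vec (Maybe A) k) → Vec (Fin k) (size p)
columns []            = []
columns (nothing ∷ p) = map suc (columns p)
columns (just _ ∷ p)  = zero ∷ map suc (columns p)

values : (p : Vec (Maybe A) k) → Vec A (size p)
values []            = []
values (nothing ∷ p) = values p
values (just x ∷ p)  = x ∷ values p

columns-unique : (p : Vec (Maybe A) k) → Unique (columns p)
columns-unique []            = []
columns-unique (nothing ∷ p) = Unique.map⁺ suc-injective (columns-unique p)
columns-unique (just _ ∷ p)  =
  All.map⁺ (All.universal (λ _ ()) (columns p)) ∷ Unique.map⁺ suc-injective (columns-unique p)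

≼-columns : (p : Pattern q k) (r : Vec (Fin q) k) → values p ≡ map (lookup r) (columns p) ⇔ p ≼ r
≼-columns []            []      = mk⇔ (λ _ → []) (λ _ → refl)
≼-columns (nothing ∷ p) (x ∷ r) rewrite sym (map-∘ (lookup (x ∷ r)) suc (columns p)) = mk⇔
  (λ eq → Maybe.nothing ∷ to (≼-columns p r) eq)
  (λ { (_ ∷ p≼r) → from (≼-columns p r) p≼r })
≼-columns (just y ∷ p)  (x ∷ r) rewrite sym (map-∘ (lookup (x ∷ r)) suc (columns p)) = mk⇔
  (λ eq → let y≡x , eq′ = ∷-injective eq in Maybe.just (sym y≡x) ∷ to (≼-columns p r) eq′)
  (λ { (Maybe.just x≡y ∷ p≼r) → cong₂ _∷_ (sym x≡y) (from (≼-columns p r) p≼r) })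

-- The way back from `columns` and `values`. A repeated column would be overwritten, so the
-- properties below that count or match entries assume `Unique cs`.
assign : Vec (Fin k) t → Vec A t → Vec (Maybe A) k
assign []       []      = replicate _ nothing
assign (c ∷ cs) (x ∷ u) = assign cs u [ c ]≔ just x

assign-free : ∀ {c : Fin k} {cs : Vec (Fin k) t} (u : Vec A t) → All (c ≢_) cs → assign cs u [ c ]= nothing
assign-free {c = c} []      []          = lookup⇒[]= c _ (lookup-replicate c nothing)
assign-free {c = c} (x ∷ u) (c≢d ∷ c∉cs) = []≔-minimal _ _ _ c≢d (assign-free u c∉cs)

size-assign : {cs : Vec (Fin k) t} (u : Vec A t) → Unique cs → size (assign cs u) ≡ t
size-assign {k = k} []      []           = size-free k
size-assign         (x ∷ u) (c∉cs ∷ ucs) =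
  trans (size-≔ x (assign-free u c∉cs)) (cong suc (size-assign u ucs))

≼-assign : {cs : Vec (Fin k) t} (u : Vec (Fin q) t) (r : Vec (Fin q) k) → Unique cs →
           u ≡ map (lookup r) cs ⇔ assign cs u ≼ r
≼-assign []      r []           = mk⇔ (λ _ → free-≼ r) (λ _ → refl)
≼-assign (x ∷ u) r (c∉cs ∷ ucs) = mk⇔
  (λ eq → let x≡ , eq′ = ∷-injective eq in
    from (≔-≼ x (assign-free u c∉cs)) (sym x≡ , to (≼-assign u r ucs) eq′))
  (λ p≼r → let ≡x , p≼r′ = to (≔-≼ x (assign-free u c∉cs)) p≼r in
    cong₂ _∷_ (sym ≡x) (from (≼-assign u r ucs) p≼r′))

-- Balanced patterns

Rows : ℕ → ℕ → Set
Rows q k = List (Vec (Fin q) k)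

hits : Pattern q k → Rows q k → ℕ
hits p rows = sum (List.map (λ r → 𝟙 (p ≼? r)) rows)

-- Multiplied out, so that neither division nor divisibility has to be mentioned.
Balanced : Rows q k → Pattern q k → Set
Balanced {q} rows p = q ^ size p * hits p rows ≡ length rows

BalancedUpTo : Rows q k → ℕ → Set
BalancedUpTo rows t = ∀ p → size p ≤ t → Balanced rows p

balancedUpTo? : (rows : Rows q k) → Decidable (BalancedUpTo rows)
balancedUpTo? rows t = allPatterns? (λ p → (size p ≤? t) →-dec (_ ℕ.≟ _))

hits-free : (rows : Rows q k) → hits (replicate k nothing) rows ≡ length rows
hits-free List.[]         = refl
hits-free (r List.∷ rows) = cong₂ _+_
  (𝟙-cong (_ ≼? r) (yes (free-≼ r)) (mk⇔ id id)) (hits-free rows)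

-- A row has exactly one letter in column `i`, so the rows extending `p` are partitioned by that
-- letter. The induction over the rows inserts this as a sum of Kronecker deltas.
hits-≔ : ∀ {p : Pattern q k} {i} → p [ i ]= nothing → ∀ rows →
         hits p rows ≡ ∑.sum (λ x → hits (p [ i ]≔ just x) rows)
hits-≔ {q} p[i] List.[] = sym (∑.sum-replicate-zero q)
hits-≔ {q} {p = p} {i} p[i] (r List.∷ rows) = begin
  𝟙 (p ≼? r) + hits p rows
    ≡⟨ cong₂ _+_ (sym (∑-𝟙-≟ (lookup r i) (𝟙 (p ≼? r)))) (hits-≔ p[i] rows) ⟩
  ∑.sum (λ x → 𝟙 (lookup r i ≟ x) * 𝟙 (p ≼? r)) + ∑.sum (λ x → hits (p [ i ]≔ just x) rows)
    ≡⟨ ∑.∑-distrib-+ _ (λ x → hits (p [ i ]≔ just x) rows) ⟨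
  ∑.sum (λ x → 𝟙 (lookup r i ≟ x) * 𝟙 (p ≼? r) + hits (p [ i ]≔ just x) rows)
    ≡⟨ ∑.sum-cong-≗ (λ x → cong (_+ hits (p [ i ]≔ just x) rows) (trans
         (sym (𝟙-× (lookup r i ≟ x) (p ≼? r)))
         (𝟙-cong (lookup r i ≟ x ×-dec p ≼? r) ((p [ i ]≔ just x) ≼? r) (⇔.sym (≔-≼ x p[i]))))) ⟩
  ∑.sum (λ x → hits (p [ i ]≔ just x) (r List.∷ rows)) ∎
  where open ≡-Reasoning

hits-const : ∀ {p : Pattern q k} {i c} → p [ i ]= nothing → ∀ rows →
             (∀ x → hits (p [ i ]≔ just x) rows ≡ c) → hits p rows ≡ q * c
hits-const {q} {c = c} p[i] rows h = trans (hits-≔ p[i] rows) (trans (∑.sum-cong-≗ h) (∑-const q c))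

-- All one-letter extensions have the same size, hence, after cancelling the power, the same number
-- of hits, and the hits of `p` are `suc q` times this number. The alphabet is nonempty so that the
-- letter `zero` can serve as reference and the power can be cancelled.
balanced-fill : ∀ {p : Pattern (suc q) k} {i} → p [ i ]= nothing → ∀ rows →
                (∀ x → Balanced rows (p [ i ]≔ just x)) → Balanced rows p
balanced-fill {q} {p = p} {i} p[i] rows h = begin
  suc q ^ size p * hits p rows        ≡⟨ cong (suc q ^ size p *_) (hits-const p[i] rows hits-x) ⟩
  suc q ^ size p * (suc q * hits₀)    ≡⟨ *-assoc (suc q ^ size p) (suc q) hits₀ ⟨
  suc q ^ size p * suc q * hits₀      ≡⟨ cong (_* hits₀) (*-comm (suc q ^ size p) (suc q)) ⟩
  suc q ^ suc (size p) * hits₀        ≡⟨ h′ zero ⟩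
  length rows                         ∎
  where
  open ≡-Reasoning
  hits₀ = hits (p [ i ]≔ just zero) rows
  h′ : ∀ x → suc q ^ suc (size p) * hits (p [ i ]≔ just x) rows ≡ length rows
  h′ x = subst (λ s → suc q ^ s * hits (p [ i ]≔ just x) rows ≡ length rows) (size-≔ x p[i]) (h x)
  hits-x : ∀ x → hits (p [ i ]≔ just x) rows ≡ hits₀
  hits-x x = *-cancelˡ-≡ _ _ (suc q ^ suc (size p)) {{m^n≢0 (suc q) (suc (size p))}}
    (trans (h′ x) (sym (h′ zero)))

module _ (rows : Rows q k) {c} (t≤k : t ≤ k)
         (hits≡c : ∀ p → size p ≡ t → hits p rows ≡ c) where

  private
    -- Each of the `d` columns still missing from `p` multiplies the count by `q`. A free column
    -- exists because `size p < t ≤ k`.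
    hits-smaller : ∀ d p → size p + d ≡ t → hits p rows ≡ q ^ d * c
    hits-smaller zero    p eq = trans (hits≡c p (trans (sym (+-identityʳ _)) eq)) (sym (*-identityˡ c))
    hits-smaller (suc d) p eq =
      let eq′ = trans (sym (+-suc (size p) d)) eq
          i , p[i] = free p (≤-trans (m≤m+n _ d) (≤-trans (≤-reflexive eq′) t≤k))
      in trans (hits-const p[i] rows λ x → hits-smaller d (p [ i ]≔ just x)
           (trans (cong (_+ d) (size-≔ x p[i])) eq′))
               (sym (*-assoc q (q ^ d) c))

  -- An orthogonal array of strength t controls only patterns of size exactly t. Smaller ones are
  -- reached by filling free columns, and the empty pattern identifies `q ^ t * c` as the number of
  -- rows.
  constant⇒balanced : BalancedUpTo rows t
  constant⇒balanced p p≤t = begin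
    q ^ size p * hits p rows                ≡⟨ cong (q ^ size p *_) (hits-smaller d p p+d≡t) ⟩
    q ^ size p * (q ^ d * c)                ≡⟨ *-assoc (q ^ size p) (q ^ d) c ⟨
    q ^ size p * q ^ d * c                  ≡⟨ cong (_* c) (^-distribˡ-+-* q (size p) d) ⟨
    q ^ (size p + d) * c                    ≡⟨ cong (λ s → q ^ s * c) p+d≡t ⟩
    q ^ t * c                               ≡⟨ hits-smaller t (replicate k nothing) (cong (_+ t) (size-free k)) ⟨
    hits (replicate k nothing) rows         ≡⟨ hits-free rows ⟩
    length rows                             ∎
    where
    open ≡-Reasoning
    d = t ∸ size p
    p+d≡t = m+[n∸m]≡n p≤t

-- Orthogonal arrays in terms of balanced patterns.

occurrences≡hits : {cols : Vec (Fin k) t} {u : Vec (Fin q) t} {p : Pattern q k} →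
                   (∀ r → u ≡ map (lookup r) cols ⇔ p ≼ r) → (A : Array q N k) →
                   occurrences u (subarray cols A) ≡ hits p (toList A)
occurrences≡hits {cols = cols} {u} {p} u⇔p A = begin
  occurrences u (subarray cols A)
    ≡⟨ count≡sum _ (subarray cols A) ⟩
  sum (List.map (𝟙 ∘ ≡-dec _≟_ u) (toList (subarray cols A)))
    ≡⟨ cong (sum ∘ List.map _) (toList-map _ A) ⟩
  sum (List.map (𝟙 ∘ ≡-dec _≟_ u) (List.map (λ r → map (lookup r) cols) (toList A)))
    ≡⟨ cong sum (List.map-∘ (toList A)) ⟨
  sum (List.map (λ r → 𝟙 (≡-dec _≟_ u (map (lookup r) cols))) (toList A))
    ≡⟨ cong sum (List.map-cong (λ r → 𝟙-cong (≡-dec _≟_ u _) (p ≼? r) (u⇔p r)) (toList A)) ⟩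
  hits p (toList A) ∎
  where open ≡-Reasoning

oa⇒constant : ∀ {A : Array q N k} {c} → IsOrthogonalArray A t c →
              ∀ p → size p ≡ t → hits p (toList A) ≡ c
oa⇒constant {A = A} oa p refl = trans
  (sym (occurrences≡hits (≼-columns p) A))
  (IsOrthogonalArray.balance oa (columns p) (columns-unique p) (values p))

oa⇒balanced : ∀ {A : Array q N k} {c} → IsOrthogonalArray A t c → BalancedUpTo (toList A) t
oa⇒balanced {A = A} oa = constant⇒balanced (toList A) (IsOrthogonalArray.t≤k oa) (oa⇒constant oa)

-- The index has to be N / q^t, with alphabet size q. The division is exact because a balanced
-- pattern of size t exhibits the number of rows as a multiple of q^t.
balanced⇒oa : ∀ {A : Array (suc q) N k} → t ≤ k → BalancedUpTo (toList A) t →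
              ∃[ c ] IsOrthogonalArray A t c
balanced⇒oa {q} {t = t} {A = A} t≤k bal = length (toList A) / suc q ^ t , record
  { t≤k     = t≤k
  ; balance = λ cols ucols u →
      let p      = assign cols u
          size≡t = size-assign u ucols
      in begin
        occurrences u (subarray cols A)            ≡⟨ occurrences≡hits (λ r → ≼-assign u r ucols) A ⟩
        hits p (toList A)                          ≡⟨ m*n/n≡m _ (suc q ^ t) ⟨
        hits p (toList A) * suc q ^ t / suc q ^ t  ≡⟨ /-congˡ (*-comm _ (suc q ^ t)) ⟩
        suc q ^ t * hits p (toList A) / suc q ^ t
          ≡⟨ /-congˡ (subst (λ s → suc q ^ s * hits p (toList A) ≡ length (toList A)) size≡t
                       (bal p (≤-reflexive size≡t))) ⟩
        length (toList A) / suc q ^ t              ∎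
  }
  where
  open ≡-Reasoning
  instance _ = m^n≢0 (suc q) t

-- Independence of the listing

toList-unique : {xs : Vec A n} → Unique xs → Uniqueₗ (toList xs)
toList-unique []         = []
toList-unique (x∉ ∷ uxs) = All.toList⁺ x∉ ∷ toList-unique uxs

module _ {D : Code ℓ (Fin q) k} where

  -- Two duplicate-free lists with the same members are equal as bags.
  lists-↭ : {A : Array q N k} {B : Array q m k} → Lists A D → Lists B D → toList A ↭ toList B
  lists-↭ LA LB = ∼bag⇒↭ (unique∧set⇒bag
    (toList-unique (distinct LA)) (toList-unique (distinct LB))
    (λ {w} → mk⇔
      (∈-toList⁺ ∘ from (rows LB w) ∘ to (rows LA w) ∘ ∈-toList⁻)
      (∈-toList⁺ ∘ from (rows LA w) ∘ to (rows LB w) ∘ ∈-toList⁻)))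
    where open Lists

balanced-↭ : {rows rows′ : Rows q k} → rows ↭ rows′ → ∀ p → Balanced rows p → Balanced rows′ p
balanced-↭ {q} σ p = subst₂ (λ h l → q ^ size p * h ≡ l) (sum-↭ (↭-map⁺ _ σ)) (↭-length σ)

-- `OAOfStrength` quantifies over all listings of the code. Since any two are permutations of each
-- other, the question reduces to one fixed listing, where it is decidable.
oaOfStrength⇔ : {D : Code ℓ (Fin (suc q)) k} {A : Array (suc q) N k} → Lists A D →
                OAOfStrength D t ⇔ (t ≤ k × BalancedUpTo (toList A) t)
oaOfStrength⇔ LA = mk⇔
  (λ (_ , _ , LB , _ , oa) → IsOrthogonalArray.t≤k oa ,
    λ p p≤t → balanced-↭ (lists-↭ LB LA) p (oa⇒balanced oa p p≤t))
  (λ (t≤k , bal) → _ , _ , LA , balanced⇒oa t≤k bal)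

-- The Gray map

gray₁⁻¹ : Vec (ℤ/ 2) 2 → ℤ/ 4
gray₁⁻¹ (0F ∷ 0F ∷ []) = 0F
gray₁⁻¹ (0F ∷ 1F ∷ []) = 1F
gray₁⁻¹ (1F ∷ 1F ∷ []) = 2F
gray₁⁻¹ (1F ∷ 0F ∷ []) = 3F

gray₁⁻¹∘gray₁ : ∀ x → gray₁⁻¹ (gray₁ x) ≡ x
gray₁⁻¹∘gray₁ 0F = refl
gray₁⁻¹∘gray₁ 1F = refl
gray₁⁻¹∘gray₁ 2F = refl
gray₁⁻¹∘gray₁ 3F = refl

gray₁∘gray₁⁻¹ : ∀ w → gray₁ (gray₁⁻¹ w) ≡ w
gray₁∘gray₁⁻¹ (0F ∷ 0F ∷ []) = refl
gray₁∘gray₁⁻¹ (0F ∷ 1F ∷ []) = refl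
gray₁∘gray₁⁻¹ (1F ∷ 1F ∷ []) = refl
gray₁∘gray₁⁻¹ (1F ∷ 0F ∷ []) = refl

gray₁-injective : ∀ {x y} → gray₁ x ≡ gray₁ y → x ≡ y
gray₁-injective {x} {y} eq =
  trans (sym (gray₁⁻¹∘gray₁ x)) (trans (cong gray₁⁻¹ eq) (gray₁⁻¹∘gray₁ y))

gray-injective : {v w : Vec (ℤ/ 4) n} → gray v ≡ gray w → v ≡ w
gray-injective {v = []}    {[]}    _  = refl
gray-injective {v = x ∷ v} {y ∷ w} eq =
  let eq₁ , eq₂ = ++-injective (gray₁ x) (gray₁ y) eq
  in cong₂ _∷_ (gray₁-injective eq₁) (gray-injective eq₂)

∈-map⁻ : ∀ {f : A → B} {w} {xs : Vec A n} → w ∈ᵛ map f xs → ∃[ v ] v ∈ᵛ xs × f v ≡ w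
∈-map⁻ {xs = x ∷ _} (here refl) = x , here refl , refl
∈-map⁻ {xs = _ ∷ _} (there w∈)  = map₂ (map₁ there) (∈-map⁻ w∈)

-- Injectivity of the Gray map keeps the rows distinct, so the image has as many words as the code.
lists-gray : {C : Code ℓ (ℤ/ 4) n} {A : Array 4 N n} → Lists A C → Lists (map gray A) (GrayImage C)
lists-gray {A = A} LA = record
  { distinct = Unique.map⁺ gray-injective distinct
  ; rows     = λ w → mk⇔
      (λ w∈ → let v , v∈ , eq = ∈-map⁻ w∈ in v , to (rows v) v∈ , eq)
      (λ { (v , v∈ , refl) → ∈-map⁺ gray (from (rows v) v∈) })
  }
  where open Lists LA

-- Patterns under the Gray map.

grayBlock : Maybe (ℤ/ 4) → Pattern 2 2
grayBlock nothing  = nothing ∷ nothing ∷ []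
grayBlock (just x) = map just (gray₁ x)

grayPattern : Pattern 4 n → Pattern 2 (n * 2)
grayPattern p = concat (map grayBlock p)

≼-just : ∀ {p : Pattern q k} {r} (u v : Vec (Fin q) m) → map just u ++ p ≼ v ++ r ⇔ (v ≡ u × p ≼ r)
≼-just []      []      = mk⇔ (refl ,_) proj₂
≼-just (x ∷ u) (y ∷ v) = mk⇔
  (λ { (Maybe.just y≡x ∷ p≼r) → map₁ (cong₂ _∷_ y≡x) (to (≼-just u v) p≼r) })
  (λ { (refl , p≼r) → Maybe.just refl ∷ from (≼-just u v) (refl , p≼r) })

≼-nothing : ∀ {p : Pattern q k} {r} (v : Vec (Fin q) 2) →
            nothing ∷ nothing ∷ p ≼ v ++ r ⇔ p ≼ r
≼-nothing (_ ∷ _ ∷ []) = mk⇔ (λ { (_ ∷ _ ∷ p≼r) → p≼r }) (λ p≼r → Maybe.nothing ∷ Maybe.nothing ∷ p≼r)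

-- Fixing a letter amounts to fixing both bits of its block, because `gray₁` is injective.
≼-gray : (p : Pattern 4 n) (r : Vec (ℤ/ 4) n) → p ≼ r ⇔ grayPattern p ≼ gray r
≼-gray []            []      = mk⇔ (λ _ → []) (λ _ → [])
≼-gray (nothing ∷ p) (x ∷ r) = mk⇔
  (λ { (_ ∷ p≼r) → from (≼-nothing (gray₁ x)) (to (≼-gray p r) p≼r) })
  (λ p≼r → Maybe.nothing ∷ from (≼-gray p r) (to (≼-nothing (gray₁ x)) p≼r))
≼-gray (just y ∷ p)  (x ∷ r) = mk⇔
  (λ { (Maybe.just x≡y ∷ p≼r) →
    from (≼-just (gray₁ y) (gray₁ x)) (cong gray₁ x≡y , to (≼-gray p r) p≼r) })
  (λ p≼r → let eq , p≼r′ = to (≼-just (gray₁ y) (gray₁ x)) p≼r in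
    Maybe.just (gray₁-injective eq) ∷ from (≼-gray p r) p≼r′)

size-just : (u : Vec A m) (p : Vec (Maybe A) k) → size (map just u ++ p) ≡ m + size p
size-just []      p = refl
size-just (x ∷ u) p = cong suc (size-just u p)

size-gray : (p : Pattern 4 n) → size (grayPattern p) ≡ 2 * size p
size-gray []            = refl
size-gray (nothing ∷ p) = size-gray p
size-gray (just x ∷ p)  = begin
  size (map just (gray₁ x) ++ grayPattern p)  ≡⟨ size-just (gray₁ x) (grayPattern p) ⟩
  2 + size (grayPattern p)                    ≡⟨ cong (2 +_) (size-gray p) ⟩
  2 + 2 * size p                              ≡⟨ *-suc 2 (size p) ⟨
  2 * suc (size p)                            ∎
  where open ≡-Reasoning

-- The two equations agree side by side: 4^r = 2^(2r) for r the size of `p`, the hits correspond row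
-- by row, and the numbers of rows coincide.
balanced-gray : (A : Array 4 N n) (p : Pattern 4 n) →
                Balanced (toList A) p ⇔ Balanced (toList (map gray A)) (grayPattern p)
balanced-gray A p = mk⇔ (subst id eq) (subst id (sym eq))
  where
  open ≡-Reasoning
  rows = toList A
  hits-gray : hits p rows ≡ hits (grayPattern p) (toList (map gray A))
  hits-gray = begin
    hits p rows
      ≡⟨ cong sum (List.map-cong (λ r → 𝟙-cong (p ≼? r) (_ ≼? _) (≼-gray p r)) rows) ⟩
    sum (List.map (λ r → 𝟙 (grayPattern p ≼? gray r)) rows)
      ≡⟨ cong sum (List.map-∘ rows) ⟩
    hits (grayPattern p) (List.map gray rows)
      ≡⟨ cong (hits (grayPattern p)) (toList-map gray A) ⟨
    hits (grayPattern p) (toList (map gray A)) ∎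
  pow : 4 ^ size p ≡ 2 ^ size (grayPattern p)
  pow = trans (^-*-assoc 2 2 (size p)) (cong (2 ^_) (sym (size-gray p)))
  eq : Balanced rows p ≡ Balanced (toList (map gray A)) (grayPattern p)
  eq = cong₂ _≡_ (cong₂ _*_ pow hits-gray)
         (trans (length-toList A) (sym (length-toList (map gray A))))

-- Completing half filled blocks.

blocks : ∀ n → Pattern 2 (n * 2) → ℕ
blocks zero    []                      = 0
blocks (suc n) (nothing ∷ nothing ∷ p) = blocks n p
blocks (suc n) (just _  ∷ _       ∷ p) = suc (blocks n p)
blocks (suc n) (nothing ∷ just _  ∷ p) = suc (blocks n p)

halfBlocks : ∀ n → Pattern 2 (n * 2) → ℕ
halfBlocks zero    []                      = 0
halfBlocks (suc n) (nothing ∷ nothing ∷ p) = halfBlocks n p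
halfBlocks (suc n) (just _  ∷ just _  ∷ p) = halfBlocks n p
halfBlocks (suc n) (just _  ∷ nothing ∷ p) = suc (halfBlocks n p)
halfBlocks (suc n) (nothing ∷ just _  ∷ p) = suc (halfBlocks n p)

blocks≤size : ∀ n p → blocks n p ≤ size p
blocks≤size zero    []                      = z≤n
blocks≤size (suc n) (nothing ∷ nothing ∷ p) = blocks≤size n p
blocks≤size (suc n) (just _  ∷ just _  ∷ p) = s≤s (m≤n⇒m≤1+n (blocks≤size n p))
blocks≤size (suc n) (just _  ∷ nothing ∷ p) = s≤s (blocks≤size n p)
blocks≤size (suc n) (nothing ∷ just _  ∷ p) = s≤s (blocks≤size n p)

-- Without half filled blocks every block is empty or full, and a full one is the Gray image of a
-- letter because `gray₁` is onto.
ungrayPattern : ∀ n p → halfBlocks n p ≡ 0 → ∃[ s ] grayPattern {n} s ≡ p × size s ≡ blocks n p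
ungrayPattern zero    []                      _  = [] , refl , refl
ungrayPattern (suc n) (nothing ∷ nothing ∷ p) h≡0 =
  let s , eq , size≡ = ungrayPattern n p h≡0
  in nothing ∷ s , cong (λ p → nothing ∷ nothing ∷ p) eq , size≡
ungrayPattern (suc n) (just x  ∷ just y  ∷ p) h≡0 =
  let s , eq , size≡ = ungrayPattern n p h≡0
  in just (gray₁⁻¹ (x ∷ y ∷ [])) ∷ s ,
     cong₂ (λ w p → map just w ++ p) (gray₁∘gray₁⁻¹ (x ∷ y ∷ [])) eq , cong suc size≡

-- The column `i` is chosen before the letter `x`, as `balanced-fill` requires all extensions by one
-- column. Completing a block meets no new block.
fillHalfBlock : ∀ n p {h} → halfBlocks n p ≡ suc h →
                ∃[ i ] p [ i ]= nothing × (∀ x →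
                  halfBlocks n (p [ i ]≔ just x) ≡ h × blocks n (p [ i ]≔ just x) ≡ blocks n p)
fillHalfBlock zero    []                      ()
fillHalfBlock (suc n) (nothing ∷ nothing ∷ p) eq =
  let i , p[i] , h = fillHalfBlock n p eq in suc (suc i) , there (there p[i]) , h
fillHalfBlock (suc n) (just _  ∷ just _  ∷ p) eq =
  let i , p[i] , h = fillHalfBlock n p eq
  in suc (suc i) , there (there p[i]) , map₂ (cong suc) ∘ h
fillHalfBlock (suc n) (just _  ∷ nothing ∷ p) eq = 1F , there here , λ _ → ℕ.suc-injective eq , refl
fillHalfBlock (suc n) (nothing ∷ just _  ∷ p) eq = 0F , here , λ _ → ℕ.suc-injective eq , refl

module _ (A : Array 4 N n) where

  -- Induction on the number of half filled blocks. With none left, the pattern comes from one on C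
  -- that fixes one letter per block met. The bound is on `blocks` rather than on `size`, since
  -- filling increases the size but not the number of blocks met.
  balanced-blocks : BalancedUpTo (toList A) t → ∀ h p → halfBlocks n p ≡ h → blocks n p ≤ t →
                    Balanced (toList (map gray A)) p
  balanced-blocks bal zero    p eq b≤t with ungrayPattern n p eq
  ... | s , refl , size≡ = to (balanced-gray A s) (bal s (≤-trans (≤-reflexive size≡) b≤t))
  balanced-blocks bal (suc h) p eq b≤t =
    let i , p[i] , fill = fillHalfBlock n p eq
    in balanced-fill p[i] (toList (map gray A)) λ x → let h≡ , b≡ = fill x in
         balanced-blocks bal h _ h≡ (≤-trans (≤-reflexive b≡) b≤t)

  balancedUpTo-gray : BalancedUpTo (toList A) t → BalancedUpTo (toList (map gray A)) t
  balancedUpTo-gray bal p p≤t = balanced-blocks bal _ p refl (≤-trans (blocks≤size n p) p≤t)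

  balancedUpTo-ungray : BalancedUpTo (toList (map gray A)) (2 * t) → BalancedUpTo (toList A) t
  balancedUpTo-ungray bal p p≤t = from (balanced-gray A p)
    (bal (grayPattern p) (≤-trans (≤-reflexive (size-gray p)) (*-monoʳ-≤ 2 p≤t)))

-- The strength of the Gray image and its bounds.

corollary4p2 : ∀ {ℓ} (n : ℕ) → 1 ≤ n →
    (C : Code ℓ (ℤ/ 4) n) → IsLinear C →
    (t : ℕ) → HasStr C t →
    ∃[ s ] HasStr (GrayImage C) s × t ≤ s × s ≤ 2 * t + 1
corollary4p2 n _ C _ t strC = s , strC′ , t≤s , s≤2t+1
  where
  open HasStr strC
  arr   = proj₁ (proj₂ attained)
  LA    = proj₁ (proj₂ (proj₂ attained))
  LA′   = lists-gray LA
  rows′ = toList (map gray arr)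

  t≤n = proj₁ (to (oaOfStrength⇔ LA) attained)
  bal = proj₂ (to (oaOfStrength⇔ LA) attained)

  IsStrength : ℕ → Set
  IsStrength s = s ≤ n * 2 × BalancedUpTo rows′ s

  -- The length of the image bounds its strength, hence the search limit. Strength 0, the base of
  -- the search, is inherited from C.
  strength′ = greatest {P = IsStrength} (λ s → (s ≤? n * 2) ×-dec balancedUpTo? rows′ s)
    (z≤n , balancedUpTo-gray arr λ p p≤0 → bal p (≤-trans p≤0 z≤n)) (n * 2)
  s     = proj₁ strength′
  s-oa  = proj₁ (proj₂ strength′)
  s-max = proj₂ (proj₂ strength′)

  strC′ : HasStr (GrayImage C) s
  strC′ = record
    { attained = from (oaOfStrength⇔ LA′) s-oa
    ; largest  = λ r oa → let r-oa = to (oaOfStrength⇔ LA′) oa in s-max r (proj₁ r-oa) r-oa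
    }

  t≤2n : t ≤ n * 2
  t≤2n = ≤-trans t≤n (m≤m*n n 2)

  t≤s : t ≤ s
  t≤s = s-max t t≤2n (t≤2n , balancedUpTo-gray arr bal)

  -- Otherwise C′ has strength 2(t+1), and thus C has strength t+1.
  s≤2t+1 : s ≤ 2 * t + 1
  s≤2t+1 = ≮⇒≥ λ 2t+1<s →
    let 2[1+t]≤s = ≤-trans (≤-reflexive (trans (*-suc 2 t) (cong suc (+-comm 1 (2 * t))))) 2t+1<s
        -- Strength t+1 of C also demands t+1 ≤ n, which follows from 2(t+1) ≤ s ≤ 2n.
        1+t≤n    = *-cancelˡ-≤ 2 (≤-trans 2[1+t]≤s (≤-trans (proj₁ s-oa) (≤-reflexive (*-comm n 2))))
    in 1+n≰n (largest (suc t) (from (oaOfStrength⇔ LA)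
         (1+t≤n , balancedUpTo-ungray arr λ p p≤ → proj₂ s-oa p (≤-trans p≤ 2[1+t]≤s))))
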